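{- The generating function $$F_{(123,132)}(x,p,q,u,v,s,t)=\sum_{n\ge0}\ \sum_{\pi\in S_n(123,132)} x^n p^{\operatorname{asc}(\pi)}q^{\operatorname{des}(\pi)}u^{\operatorname{lrmax}(\pi)}v^{\operatorname{rlmax}(\pi)}s^{\operatorname{lrmin}(\pi)}t^{\operatorname{rlmin}(\pi)}$$ is equal to $$\frac{1 + q^2 s^2 v x^2 + s t u v x (1 + p t u x) - q s x \bigl(1 + p u v^2 x^2 s t(-1 + t)(-1 + u) + v (1 + p x + s t u x)\bigr)}{1 + q^2 s^2 v x^2 - q s x (1 + v + p v x)}.$$
   Context: For $n\ge 0$, $S_n$ denotes the set of permutations $\pi=\pi_1\cdots\pi_n$ of $[n]=\{1,\dots,n\}$ ($S_0$ consists of the empty permutation, for which all statistics are $0$). $\pi$ avoids a pattern $\tau\in S_k$ if no subsequence $\pi_{i_1}\cdots\pi_{i_k}$ ($i_1<\dots<i_k$) satisfies $\pi_{i_a}<\pi_{i_b}\iff\tau_a<\tau_b$; $S_n(\tau,\rho)$ is the set of permutations in $S_n$ avoiding both $\tau$ and $\rho$. $\operatorname{asc}(\pi)$ (resp. $\operatorname{des}(\pi)$) is the number of $i\in[n-1]$ with $\pi_i<\pi_{i+1}$ (resp. $\pi_i>\pi_{i+1}$). $\pi_i$ is a left-to-right maximum (resp. minimum) if it is larger (resp. smaller) than every $\pi_j$ with $j<i$, and a right-to-left maximum (resp. minimum) if it is larger (resp. smaller) than every $\pi_j$ with $j>i$; $\operatorname{lrmax},\operatorname{lrmin},\operatorname{rlmax},\operatorname{rlmin}$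 count these (so $\pi_1$ is always a left-to-right maximum and minimum, $\pi_n$ always a right-to-left maximum and minimum). -}

module Defs where

open import Algebra.Bundles using (CommutativeRing)
open import Algebra.Structures using (IsCommutativeRing)
open import Data.Fin.Base using (Fin; zero; suc; toℕ; inject₁; _<_)
open import Data.Fin.Patterns using (0F; 1F; 2F)
open import Data.Fin.Properties using (_≟_; _<?_; all?)
open import Data.List.Base as List using (List; cartesianProductWith; filter)
open import Data.List.Membership.Propositional using (_∈_; lose)
open import Data.List.Membership.Propositional.Properties
  using (∈-allFin; ∈-cartesianProductWith⁺; ∈-filter⁺; ∈-filter⁻)
open import Data.List.Relation.Unary.Any as Any using (here)
import Data.List.Relation.Unary.All as All
import Data.List.Relation.Unary.AllPairs as AllPairs
import Data.List.Relation.Unary.Unique.Propositional as Unique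
import Data.List.Relation.Unary.Unique.Propositional.Properties as Unique
open import Data.Nat.Base using (ℕ; zero; suc; _∸_)
open import Data.Product.Base using (_×_; _,_; proj₂; ∃-syntax)
open import Data.Vec.Base using (Vec; []; _∷_; lookup; allFin; count)
open import Data.Vec.Properties using (∷-injective)
open import Data.Vec.Relation.Unary.AllPairs using (allPairs?)
open import Data.Vec.Relation.Unary.Unique.Propositional using (Unique)
open import Function.Bundles using (_⇔_; mk⇔; Equivalence)
open import Level using (Level)
open import Relation.Binary.PropositionalEquality.Core using (refl)
open import Relation.Nullary.Decidable
  using (Dec; map′; _×-dec_; _→-dec_; ¬?)
open import Relation.Nullary.Negation using (¬_)
import Algebra.Properties.Semiring.Exp as Exp
import Relation.Binary.Reasoning.Setoid as SetoidReasoning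

private
  variable
    k m n : ℕ

words : ∀ m n → List (Vec (Fin m) n)
words m zero    = List.[ [] ]
words m (suc n) = cartesianProductWith _∷_ (List.allFin m) (words m n)

∈-words : (w : Vec (Fin m) n) → w ∈ words m n
∈-words []      = here refl
∈-words (a ∷ w) = ∈-cartesianProductWith⁺ _∷_ (∈-allFin a) (∈-words w)

words-unique : ∀ m n → Unique.Unique (words m n)
words-unique m zero    = All.[] AllPairs.∷ AllPairs.[]
words-unique m (suc n) =
  Unique.cartesianProductWith⁺ _∷_ ∷-injective (Unique.allFin⁺ m) (words-unique m n)

-- A permutation of [n] in one-line notation is a word of length n over an
-- n-letter alphabet (here 0, …, n-1 instead of 1, …, n) without repetition.

permutations : ∀ n → List (Vec (Fin n) n)
permutations n = filter (allPairs? (λ a b → ¬? (a ≟ b))) (words n n)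

∈-permutations⇔Unique : (π : Vec (Fin n) n) → π ∈ permutations n ⇔ Unique π
∈-permutations⇔Unique π = mk⇔
  (λ π∈ → proj₂ (∈-filter⁻ _ {xs = words _ _} π∈))
  (∈-filter⁺ _ (∈-words π))

permutations-unique : ∀ n → Unique.Unique (permutations n)
permutations-unique n = Unique.filter⁺ _ (words-unique n n)

_⇔-dec_ : ∀ {a b} {A : Set a} {B : Set b} → Dec A → Dec B → Dec (A ⇔ B)
a? ⇔-dec b? = map′
  (λ (to , from) → mk⇔ to from)
  (λ e → Equivalence.to e , Equivalence.from e)
  ((a? →-dec b?) ×-dec (b? →-dec a?))

-- ι lists the positions i₁ < … < iₖ of an occurrence of τ in π.

Occurrence : Vec (Fin k) k → Vec (Fin m) n → Vec (Fin n) k → Set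
Occurrence τ π ι =
  (∀ a b → a < b → lookup ι a < lookup ι b) ×
  (∀ a b → lookup π (lookup ι a) < lookup π (lookup ι b) ⇔ lookup τ a < lookup τ b)

occurrence? : (τ : Vec (Fin k) k) (π : Vec (Fin m) n) (ι : Vec (Fin n) k) →
              Dec (Occurrence τ π ι)
occurrence? τ π ι =
  all? (λ a → all? λ b → (a <? b) →-dec (lookup ι a <? lookup ι b)) ×-dec
  all? (λ a → all? λ b →
    (lookup π (lookup ι a) <? lookup π (lookup ι b)) ⇔-dec (lookup τ a <? lookup τ b))

Avoids : Vec (Fin k) k → Vec (Fin m) n → Set
Avoids τ π = ¬ (∃[ ι ] Occurrence τ π ι)

avoids? : (τ : Vec (Fin k) k) (π : Vec (Fin m) n) → Dec (Avoids τ π)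
avoids? τ π = ¬? (map′ Any.satisfied
  (λ (ι , occ) → lose (∈-words ι) occ)
  (Any.any? (occurrence? τ π) (words _ _)))

S : ∀ n → Vec (Fin k) k → Vec (Fin m) m → List (Vec (Fin n) n)
S n τ ρ = filter (λ π → avoids? τ π ×-dec avoids? ρ π) (permutations n)

-- One-line notation starting from 0: these are 123 and 132.

[123] [132] : Vec (Fin 3) 3
[123] = 0F ∷ 1F ∷ 2F ∷ []
[132] = 0F ∷ 2F ∷ 1F ∷ []

asc des lrmax lrmin rlmax rlmin : Vec (Fin m) n → ℕ

asc {n = zero}  π = 0
asc {n = suc n} π = count (λ i → lookup π (inject₁ i) <? lookup π (suc i)) (allFin n)

des {n = zero}  π = 0
des {n = suc n} π = count (λ i → lookup π (suc i) <? lookup π (inject₁ i)) (allFin n)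

lrmax π = count (λ i → all? λ j → (j <? i) →-dec (lookup π j <? lookup π i)) (allFin _)
lrmin π = count (λ i → all? λ j → (j <? i) →-dec (lookup π i <? lookup π j)) (allFin _)
rlmax π = count (λ i → all? λ j → (i <? j) →-dec (lookup π j <? lookup π i)) (allFin _)
rlmin π = count (λ i → all? λ j → (i <? j) →-dec (lookup π i <? lookup π j)) (allFin _)

module PowerSeries {c ℓ : Level} (R : CommutativeRing c ℓ) where

  private
    module R = CommutativeRing R
    open R using (Carrier; _≈_; 0#; 1#)
    open SetoidReasoning R.setoid
    open import Algebra.Properties.Monoid.Sum R.+-monoid using (sum)

    module Identities where
      open R using (_+_; _*_)
      open import Algebra.Solver.Ring.NaturalCoefficients.Default R.commutativeSemiring

      ⊛-suc-0 : ∀ a b c d → a * d + (b * c + 0#) ≈ (a * d + 0#) + b * c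
      ⊛-suc-0 = solve 4
        (λ a b c d → a :* d :+ (b :* c :+ con 0) := (a :* d :+ con 0) :+ b :* c) R.refl

      distribʳ-0 : ∀ a b c → (b + c) * a + 0# ≈ (b * a + 0#) + (c * a + 0#)
      distribʳ-0 = solve 3
        (λ a b c → (b :+ c) :* a :+ con 0 := (b :* a :+ con 0) :+ (c :* a :+ con 0)) R.refl

      distribʳ-suc : ∀ a b c d e → (b + c) * a + (d + e) ≈ (b * a + d) + (c * a + e)
      distribʳ-suc = solve 5
        (λ a b c d e → (b :+ c) :* a :+ (d :+ e) := (b :* a :+ d) :+ (c :* a :+ e)) R.refl

      scale-0 : ∀ a b c → (a * b) * c + 0# ≈ a * (b * c + 0#)
      scale-0 = solve 3
        (λ a b c → (a :* b) :* c :+ con 0 := a :* (b :* c :+ con 0)) R.refl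

      scale-suc : ∀ a b c d → (a * b) * c + a * d ≈ a * (b * c + d)
      scale-suc = solve 4
        (λ a b c d → (a :* b) :* c :+ a :* d := a :* (b :* c :+ d)) R.refl

      assoc-0 : ∀ a b c → (a * b + 0#) * c + 0# ≈ a * (b * c + 0#) + 0#
      assoc-0 = solve 3
        (λ a b c → (a :* b :+ con 0) :* c :+ con 0 := a :* (b :* c :+ con 0) :+ con 0) R.refl

      assoc-suc : ∀ a b c d e → (a * b + 0#) * c + (a * d + e) ≈ a * (b * c + d) + e
      assoc-suc = solve 5
        (λ a b c d e → (a :* b :+ con 0) :* c :+ (a :* d :+ e) := a :* (b :* c :+ d) :+ e) R.refl

  Series : Set c
  Series = ℕ → Carrier

  infix 4 _≋_

  -- A record rather than a function type, so that f and g can be inferred.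
  record _≋_ (f g : Series) : Set ℓ where
    constructor coefficientwise
    field coefficient : ∀ n → f n ≈ g n

  open _≋_ public

  const : Carrier → Series
  const a zero    = a
  const a (suc n) = 0#

  X : Series
  X zero    = 0#
  X (suc n) = const 1# n

  infixl 7 _⊛_
  infixl 6 _⊕_

  _⊕_ _⊛_ : Series → Series → Series
  (f ⊕ g) n = f n R.+ g n
  (f ⊛ g) n = sum {suc n} λ i → f (toℕ i) R.* g (n ∸ toℕ i)

  ⊖_ : Series → Series
  (⊖ f) n = R.- f n

  tail : Series → Series
  tail f n = f (suc n)

  -- Long division; only meaningful when d has constant coefficient 1.

  infixl 7 _/_

  _/_ : Series → Series → Series
  (f / d) zero    = f 0
  (f / d) (suc n) = ((λ i → f (suc i) R.- f 0 R.* d (suc i)) / d) n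

  private
    ⊛-cong : ∀ {f f′ g g′ : Series} → (∀ n → f n ≈ f′ n) → (∀ n → g n ≈ g′ n) →
             ∀ n → (f ⊛ g) n ≈ (f′ ⊛ g′) n
    ⊛-cong p q zero    = R.+-congʳ (R.*-cong (p 0) (q 0))
    ⊛-cong p q (suc n) = R.+-cong (R.*-cong (p 0) (q (suc n))) (⊛-cong (λ i → p (suc i)) q n)

    ⊛-suc : ∀ f g n → (f ⊛ g) (suc n) ≈ (f ⊛ tail g) n R.+ f (suc n) R.* g 0
    ⊛-suc f g zero    = Identities.⊛-suc-0 (f 0) (f 1) (g 0) (g 1)
    ⊛-suc f g (suc n) = R.trans (R.+-congˡ (⊛-suc (tail f) g n)) (R.sym (R.+-assoc _ _ _))

    ⊛-comm : ∀ f g n → (f ⊛ g) n ≈ (g ⊛ f) n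
    ⊛-comm f g zero    = R.+-congʳ (R.*-comm _ _)
    ⊛-comm f g (suc n) = begin
      f 0 R.* g (suc n) R.+ (tail f ⊛ g) n  ≈⟨ R.+-cong (R.*-comm _ _) (⊛-comm (tail f) g n) ⟩
      g (suc n) R.* f 0 R.+ (g ⊛ tail f) n  ≈⟨ R.+-comm _ _ ⟩
      (g ⊛ tail f) n R.+ g (suc n) R.* f 0  ≈⟨ ⊛-suc g f n ⟨
      (g ⊛ f) (suc n)                       ∎

    ⊛-distribʳ : ∀ f g h n → ((g ⊕ h) ⊛ f) n ≈ (g ⊛ f ⊕ h ⊛ f) n
    ⊛-distribʳ f g h zero    = Identities.distribʳ-0 (f 0) (g 0) (h 0)
    ⊛-distribʳ f g h (suc n) = R.trans
      (R.+-congˡ (⊛-distribʳ f (tail g) (tail h) n))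
      (Identities.distribʳ-suc (f (suc n)) (g 0) (h 0) _ _)

    ⊛-scale : ∀ a f g n → ((λ i → a R.* f i) ⊛ g) n ≈ a R.* (f ⊛ g) n
    ⊛-scale a f g zero    = Identities.scale-0 a (f 0) (g 0)
    ⊛-scale a f g (suc n) = R.trans
      (R.+-congˡ (⊛-scale a (tail f) g n))
      (Identities.scale-suc a (f 0) (g (suc n)) _)

    ⊛-assoc : ∀ f g h n → ((f ⊛ g) ⊛ h) n ≈ (f ⊛ (g ⊛ h)) n
    ⊛-assoc f g h zero    = Identities.assoc-0 (f 0) (g 0) (h 0)
    ⊛-assoc f g h (suc n) = begin
      (f 0 R.* g 0 R.+ 0#) R.* h (suc n) R.+ (((λ i → f 0 R.* tail g i) ⊕ tail f ⊛ g) ⊛ h) n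
        ≈⟨ R.+-congˡ (⊛-distribʳ h (λ i → f 0 R.* tail g i) (tail f ⊛ g) n) ⟩
      (f 0 R.* g 0 R.+ 0#) R.* h (suc n) R.+
        (((λ i → f 0 R.* tail g i) ⊛ h) n R.+ ((tail f ⊛ g) ⊛ h) n)
        ≈⟨ R.+-congˡ (R.+-cong (⊛-scale (f 0) (tail g) h n) (⊛-assoc (tail f) g h n)) ⟩
      (f 0 R.* g 0 R.+ 0#) R.* h (suc n) R.+
        (f 0 R.* (tail g ⊛ h) n R.+ (tail f ⊛ (g ⊛ h)) n)
        ≈⟨ Identities.assoc-suc (f 0) (g 0) (h (suc n)) _ _ ⟩
      f 0 R.* (g 0 R.* h (suc n) R.+ (tail g ⊛ h) n) R.+ (tail f ⊛ (g ⊛ h)) n ∎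

    ⊛-zeroˡ : ∀ f n → ((λ _ → 0#) ⊛ f) n ≈ 0#
    ⊛-zeroˡ f zero    = R.trans (R.+-identityʳ _) (R.zeroˡ _)
    ⊛-zeroˡ f (suc n) = R.trans (R.+-cong (R.zeroˡ _) (⊛-zeroˡ f n)) (R.+-identityˡ _)

    ⊛-identityˡ : ∀ f n → (const 1# ⊛ f) n ≈ f n
    ⊛-identityˡ f zero    = R.trans (R.+-identityʳ _) (R.*-identityˡ _)
    ⊛-identityˡ f (suc n) = R.trans (R.+-cong (R.*-identityˡ _) (⊛-zeroˡ f n)) (R.+-identityʳ _)

    isCommutativeRing : IsCommutativeRing _≋_ _⊕_ _⊛_ ⊖_ (const 0#) (const 1#)
    isCommutativeRing = record
      { isRing = record
        { +-isAbelianGroup = record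
          { isGroup = record
            { isMonoid = record
              { isSemigroup = record
                { isMagma = record
                  { isEquivalence = record
                    { refl  = coefficientwise λ n → R.refl
                    ; sym   = λ p → coefficientwise λ n → R.sym (coefficient p n)
                    ; trans = λ p q → coefficientwise λ n →
                        R.trans (coefficient p n) (coefficient q n)
                    }
                  ; ∙-cong = λ p q → coefficientwise λ n →
                      R.+-cong (coefficient p n) (coefficient q n)
                  }
                ; assoc = λ f g h → coefficientwise λ n → R.+-assoc _ _ _
                }
              ; identity =
                  (λ f → coefficientwise λ n → R.trans (R.+-congʳ (const-0 n)) (R.+-identityˡ _)) ,
                  (λ f → coefficientwise λ n → R.trans (R.+-congˡ (const-0 n)) (R.+-identityʳ _))
              }
            ; inverse =
                (λ f → coefficientwise λ n → R.trans (R.-‿inverseˡ _) (R.sym (const-0 n))) ,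
                (λ f → coefficientwise λ n → R.trans (R.-‿inverseʳ _) (R.sym (const-0 n)))
            ; ⁻¹-cong = λ p → coefficientwise λ n → R.-‿cong (coefficient p n)
            }
          ; comm = λ f g → coefficientwise λ n → R.+-comm _ _
          }
        ; *-cong = λ p q → coefficientwise (⊛-cong (coefficient p) (coefficient q))
        ; *-assoc = λ f g h → coefficientwise (⊛-assoc f g h)
        ; *-identity =
            (λ f → coefficientwise (⊛-identityˡ f)) ,
            (λ f → coefficientwise λ n → R.trans (⊛-comm f (const 1#) n) (⊛-identityˡ f n))
        ; distrib =
            (λ f g h → coefficientwise λ n → R.trans (⊛-comm f (g ⊕ h) n)
              (R.trans (⊛-distribʳ f g h n) (R.+-cong (⊛-comm g f n) (⊛-comm h f n)))) ,
            (λ f g h → coefficientwise (⊛-distribʳ f g h))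
        }
      ; *-comm = λ f g → coefficientwise (⊛-comm f g)
      }
      where
      const-0 : ∀ n → const 0# n ≈ 0#
      const-0 zero    = R.refl
      const-0 (suc n) = R.refl

  commutativeRing : CommutativeRing c ℓ
  commutativeRing = record { isCommutativeRing = isCommutativeRing }

  /-correct : ∀ f d → d 0 ≈ 1# → d ⊛ (f / d) ≋ f
  /-correct f d d₀≈1 = coefficientwise (go f)
    where
    cancel : ∀ a b c → (a R.- b R.* c) R.+ c R.* b ≈ a
    cancel a b c = R.trans (R.+-assoc _ _ _) (R.trans
      (R.+-congˡ (R.trans (R.+-congˡ (R.*-comm c b)) (R.-‿inverseˡ _)))
      (R.+-identityʳ a))

    go : ∀ f n → (d ⊛ (f / d)) n ≈ f n
    go f zero    = R.trans (R.+-identityʳ _) (R.trans (R.*-congʳ d₀≈1) (R.*-identityˡ _))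
    go f (suc n) = begin
      (d ⊛ (f / d)) (suc n)
        ≈⟨ ⊛-suc d (f / d) n ⟩
      (d ⊛ ((λ i → f (suc i) R.- f 0 R.* d (suc i)) / d)) n R.+ d (suc n) R.* f 0
        ≈⟨ R.+-congʳ (go _ n) ⟩
      (f (suc n) R.- f 0 R.* d (suc n)) R.+ d (suc n) R.* f 0
        ≈⟨ cancel _ _ _ ⟩
      f (suc n) ∎

  open CommutativeRing commutativeRing public
    using (_≈_; _+_; _*_; _-_; -_; 0#; 1#)
  open Exp (CommutativeRing.semiring commutativeRing) public
    using (_^_)

-- Elements p, q, u, v, s, t of an arbitrary commutative ring play the role of
-- the indeterminates: R = ℤ[p,q,u,v,s,t] is the universal instance.

module _ {c ℓ : Level} (R : CommutativeRing c ℓ) where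

  open CommutativeRing R
  open Exp semiring using (_^_)

  module _ (p q u v s t : Carrier) where

    weight : Vec (Fin m) n → Carrier
    weight π = p ^ asc π * q ^ des π * u ^ lrmax π * v ^ rlmax π * s ^ lrmin π * t ^ rlmin π

    F : Vec (Fin k) k → Vec (Fin m) m → PowerSeries.Series R
    F τ ρ n = List.foldr _+_ 0# (List.map weight (S n τ ρ))

{-# OPTIONS --safe #-}

-- A permutation avoids 123 and 132 exactly when every entry has at most one
-- larger entry to its right.  So the avoiders of length n + 1 arise from those of
-- length n by prepending (and renormalising) the largest or the second largest
-- value, and all six statistics change in a way that depends only on this choice
-- and on whether the previous first entry was the largest.  Leaving out the
-- factor u ^ lrmax, the generating functions A (largest entry first) and B
-- (second largest first) satisfy
--   A = x (vst + qvs (A + B)),   B = x (pA + qsB) + x² pvst (t - 1),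
-- where the last term accounts for the extra right-to-left minimum of 12, and
-- F = 1 + uA + u²B.

module Submission where

open import Defs
open import Algebra.Bundles using (CommutativeRing)
import Algebra.Properties.Group as GroupProperties
import Algebra.Properties.Ring as RingProperties
import Algebra.Properties.Semiring.Exp as Exp
open import Data.Bool.Base using (true; false)
open import Data.Empty using (⊥; ⊥-elim)
open import Data.Fin.Base
  using (Fin; zero; suc; toℕ; fromℕ; inject₁; punchIn; punchOut; _<_)
open import Data.Fin.Patterns using (0F; 1F; 2F)
import Data.Fin.Properties as Fin
open import Data.Fin.Properties using (_≟_; _<?_; all?)
open import Data.List.Base as List using (List)
open import Data.List.Membership.Propositional using (_∈_)
open import Data.List.Membership.Propositional.Properties
  using (∈-map⁺; ∈-map⁻; ∈-++⁺ˡ; ∈-++⁺ʳ; ∈-filter⁺; ∈-filter⁻)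
open import Data.List.Membership.Propositional.Properties.WithK using (unique∧set⇒bag)
open import Data.List.Relation.Binary.BagAndSetEquality using (∼bag⇒↭)
open import Data.List.Relation.Binary.Permutation.Propositional as Perm using (_↭_)
open import Data.List.Relation.Unary.Any using (here)
import Data.List.Relation.Unary.All as ListAll
import Data.List.Relation.Unary.All.Properties as ListAll
import Data.List.Relation.Unary.AllPairs as ListAllPairs
import Data.List.Relation.Unary.Unique.Propositional as ListUnique
import Data.List.Relation.Unary.Unique.Propositional.Properties as ListUnique
open import Data.Nat.Base as ℕ using (ℕ; zero; suc; z≤n; s≤s)
import Data.Nat.Properties as ℕ
open import Data.Product.Base using (_×_; _,_; proj₁; proj₂; ∃-syntax)
open import Data.Sum.Base using (inj₁; inj₂)
open import Data.Vec.Base using (Vec; []; _∷_; lookup; allFin; count; map; tabulate)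
open import Data.Vec.Properties using (∷-injectiveˡ; ∷-injectiveʳ; lookup-map)
open import Data.Vec.Relation.Unary.All using (All; []; _∷_)
import Data.Vec.Relation.Unary.All.Properties as All
open import Data.Vec.Relation.Unary.AllPairs using ([]; _∷_)
open import Data.Vec.Relation.Unary.Unique.Propositional using (Unique)
import Data.Vec.Relation.Unary.Unique.Propositional.Properties as Unique
open import Function.Base using (_∘_; id)
open import Function.Bundles using (_⇔_; mk⇔; Equivalence)
import Function.Properties.Equivalence as ⇔
open import Level using (0ℓ)
open import Relation.Binary.Core using (Rel)
open import Relation.Binary.Definitions using (Decidable; tri<; tri≈; tri>)
import Relation.Binary.PropositionalEquality as ≡
import Relation.Binary.Reasoning.Setoid as SetoidReasoning
open import Relation.Nullary.Decidable using (Dec; yes; no; does; _×-dec_; _→-dec_)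
open import Relation.Nullary.Negation using (¬_; contradiction)
open import Relation.Unary using (Pred)
import Relation.Unary as Unary

private
  variable
    k m n : ℕ

module Avoiders where

  open ≡ using (_≡_; _≢_; refl; sym; trans; cong; cong₂; subst; subst₂)
  open Equivalence using (to; from)

  -- Counting positions with a decidable property.

  module _ {P : Pred (Fin (suc n)) 0ℓ} (P? : Unary.Decidable P) where

    private
      -- `allFin (suc n)` unfolds to `zero ∷ tabulate suc`, so splitting off the first position
      -- requires moving `suc` from the tabulated function into the predicate. An arbitrary `f` lets
      -- the induction absorb the further occurrences of `suc`.
      count-tabulate : ∀ {k l} (g : Fin l → Fin (suc n)) (f : Fin k → Fin l) →
        count P? (tabulate (g ∘ f)) ≡ count (P? ∘ g) (tabulate f)
      count-tabulate {zero}  g f = refl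
      count-tabulate {suc k} g f with does (P? (g (f zero)))
      ... | true  = cong suc (count-tabulate g (f ∘ suc))
      ... | false = count-tabulate g (f ∘ suc)

    count-yes : P zero → count P? (allFin (suc n)) ≡ suc (count (P? ∘ suc) (allFin n))
    count-yes p with P? zero
    ... | yes _  = cong suc (count-tabulate suc id)
    ... | no  ¬p = contradiction p ¬p

    count-no : ¬ P zero → count P? (allFin (suc n)) ≡ count (P? ∘ suc) (allFin n)
    count-no ¬p with P? zero
    ... | yes p = contradiction p ¬p
    ... | no  _ = count-tabulate suc id

  count-cong : {P Q : Pred (Fin n) 0ℓ} (P? : Unary.Decidable P) (Q? : Unary.Decidable Q) →
    (∀ i → P i ⇔ Q i) → (is : Vec (Fin n) k) → count P? is ≡ count Q? is
  count-cong P? Q? e []       = refl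
  count-cong P? Q? e (i ∷ is) with P? i | Q? i
  ... | yes _ | yes _ = cong suc (count-cong P? Q? e is)
  ... | no  _ | no  _ = count-cong P? Q? e is
  ... | yes p | no ¬q = contradiction (to (e i) p) ¬q
  ... | no ¬p | yes q = contradiction (from (e i) q) ¬p

  count-none : {P : Pred (Fin n) 0ℓ} (P? : Unary.Decidable P) →
    (∀ i → ¬ P i) → (is : Vec (Fin n) k) → count P? is ≡ 0
  count-none P? ¬p []       = refl
  count-none P? ¬p (i ∷ is) with P? i
  ... | yes p = contradiction p (¬p i)
  ... | no  _ = count-none P? ¬p is

  count-one : {P : Pred (Fin n) 0ℓ} (P? : Unary.Decidable P) (i : Fin n) →
    P i → (∀ j → P j → i ≡ j) → count P? (allFin n) ≡ 1
  count-one P? zero    p u = trans (count-yes P? p)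
    (cong suc (count-none (P? ∘ suc) (λ j q → contradiction (u (suc j) q) λ ()) (allFin _)))
  count-one P? (suc i) p u = trans (count-no P? (λ q → contradiction (u zero q) λ ()))
    (count-one (P? ∘ suc) i p (λ j q → Fin.suc-injective (u (suc j) q)))

  -- Renormalised values and the two largest values.

  <-punchIn : ∀ (a : Fin (suc n)) j → toℕ a ℕ.≤ toℕ j → a < punchIn a j
  <-punchIn zero    j       _         = s≤s z≤n
  <-punchIn (suc a) (suc j) (s≤s a≤j) = s≤s (<-punchIn a j a≤j)

  punchIn-< : ∀ (a : Fin (suc n)) j → toℕ j ℕ.< toℕ a → punchIn a j < a
  punchIn-< (suc a) zero    _         = s≤s z≤n
  punchIn-< (suc a) (suc j) (s≤s j<a) = s≤s (punchIn-< a j j<a)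

  punchIn-mono-< : ∀ (a : Fin (suc n)) {i j} → i < j ⇔ punchIn a i < punchIn a j
  punchIn-mono-< a = mk⇔
    (λ i<j → ℕ.≰⇒> λ p → ℕ.<⇒≱ i<j (Fin.punchIn-cancel-≤ a _ _ p))
    (λ i<j → ℕ.≰⇒> λ p → ℕ.<⇒≱ i<j (Fin.punchIn-mono-≤ a _ _ p))

  top : Fin (suc n)
  top = fromℕ _

  second : Fin (suc (suc n))
  second = inject₁ top

  toℕ-top : toℕ (top {n}) ≡ n
  toℕ-top {n} = Fin.toℕ-fromℕ n

  toℕ-second : toℕ (second {n}) ≡ n
  toℕ-second = trans (Fin.toℕ-inject₁ top) toℕ-top

  toℕ≡⇒≡top : {j : Fin (suc n)} → toℕ j ≡ n → j ≡ top
  toℕ≡⇒≡top j≡ = Fin.toℕ-injective (trans j≡ (sym toℕ-top))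

  toℕ≡⇒≡second : {j : Fin (suc (suc n))} → toℕ j ≡ n → j ≡ second
  toℕ≡⇒≡second j≡ = Fin.toℕ-injective (trans j≡ (sym toℕ-second))

  ≢top⇒< : {j : Fin (suc n)} → j ≢ top → toℕ j ℕ.< n
  ≢top⇒< {n} {j} j≢ with ℕ.m<1+n⇒m<n∨m≡n (Fin.toℕ<n j)
  ... | inj₁ j<n = j<n
  ... | inj₂ j≡n = contradiction (toℕ≡⇒≡top j≡n) j≢

  ≢top⇒<top : {j : Fin (suc n)} → j ≢ top → j < top
  ≢top⇒<top {n} {j} j≢ = subst (toℕ j ℕ.<_) (sym toℕ-top) (≢top⇒< j≢)

  <⇒≢top : {i j : Fin (suc n)} → i < j → i ≢ top
  <⇒≢top {j = j} i<j refl = ℕ.<⇒≱ i<j (Fin.≤fromℕ j)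

  top≢second : top ≢ second {n}
  top≢second eq = ℕ.1+n≢n (trans (sym toℕ-top) (trans (cong toℕ eq) toℕ-second))

  punchIn-top-< : (j : Fin n) → punchIn top j < top
  punchIn-top-< j = punchIn-< top j (subst (toℕ j ℕ.<_) (sym toℕ-top) (Fin.toℕ<n j))

  punchIn-second-< : {j : Fin (suc n)} → j ≢ top → punchIn second j < second
  punchIn-second-< {j = j} j≢ =
    punchIn-< second j (subst (toℕ j ℕ.<_) (sym toℕ-second) (≢top⇒< j≢))

  -- The old largest value has the same index `n` as the new `second`, so renormalisation pushes it
  -- up by one. All smaller old values stay below `second` (`punchIn-second-<`), so the old maximum
  -- alone passes it.
  second-<-punchIn : second {n} < punchIn second top
  second-<-punchIn {n} = <-punchIn second top
    (ℕ.≤-reflexive (trans toℕ-second (sym toℕ-top)))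

  second<⇒top : {j : Fin (suc n)} → second < punchIn second j → j ≡ top
  second<⇒top {j = j} s< with j ≟ top
  ... | yes j≡ = j≡
  ... | no  j≢ = contradiction (punchIn-second-< j≢) (ℕ.<⇒≯ s<)

  -- Prepending an entry, and the pigeonhole principle.

  insert : Fin (suc m) → Vec (Fin m) n → Vec (Fin (suc m)) (suc n)
  insert a σ = a ∷ map (punchIn a) σ

  map-punchIn-injective : ∀ (a : Fin (suc m)) {σ τ : Vec (Fin m) n} →
    map (punchIn a) σ ≡ map (punchIn a) τ → σ ≡ τ
  map-punchIn-injective a {[]}    {[]}    _  = refl
  map-punchIn-injective a {x ∷ σ} {y ∷ τ} eq = cong₂ _∷_
    (Fin.punchIn-injective a x y (∷-injectiveˡ eq)) (map-punchIn-injective a (∷-injectiveʳ eq))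

  map-punchOut : ∀ (a : Fin (suc m)) {w : Vec (Fin (suc m)) n} → All (a ≢_) w →
    ∃[ σ ] map (punchIn a) σ ≡ w
  map-punchOut a []          = [] , refl
  map-punchOut a (a≢ ∷ a≢w) =
    let σ , eq = map-punchOut a a≢w
    in punchOut a≢ ∷ σ , cong₂ _∷_ (Fin.punchIn-punchOut a≢) eq

  Unique-map⁻ : ∀ {A B : Set} (f : A → B) {σ : Vec A n} → Unique (map f σ) → Unique σ
  Unique-map⁻ f {[]}    []           = []
  Unique-map⁻ f {x ∷ σ} (x∉ ∷ σ!) =
    All.lookup⁻ (λ i x≡ → All.lookup⁺ x∉ i (trans (cong f x≡) (sym (lookup-map i f σ))))
    ∷ Unique-map⁻ f σ!

  insert-Unique : ∀ (a : Fin (suc m)) {σ : Vec (Fin m) n} → Unique σ → Unique (insert a σ)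
  insert-Unique a {σ} σ! =
    All.lookup⁻ (λ i a≡ → Fin.punchInᵢ≢i a (lookup σ i) (trans (sym (lookup-map i _ σ)) (sym a≡)))
    ∷ Unique.map⁺ (Fin.punchIn-injective a _ _) σ!

  -- Pigeonhole: peel off the first entry and renormalise the others.
  Unique⇒surjective : {σ : Vec (Fin n) n} → Unique σ → ∀ v → ∃[ i ] lookup σ i ≡ v
  Unique⇒surjective {suc n} {a ∷ w} (a∉w ∷ w!) v with a ≟ v | map-punchOut a a∉w
  ... | yes a≡v | _        = zero , a≡v
  ... | no  a≢v | σ , refl =
    let i , eq = Unique⇒surjective (Unique-map⁻ (punchIn a) w!) (punchOut a≢v)
    in suc i , trans (lookup-map i _ σ) (trans (cong (punchIn a) eq) (Fin.punchIn-punchOut a≢v))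

  -- Left-to-right and right-to-left records.

  -- One treatment covers maxima and minima: with `_<_` and its converse for `R`, `lr` and `rl` are
  -- definitionally `lrmax`, `rlmax` and `lrmin`, `rlmin`. `R` is polymorphic in the alphabet
  -- because renormalisation changes the alphabet.
  module Records {R : ∀ {m} → Rel (Fin m) 0ℓ} (R? : ∀ {m} → Decidable (R {m})) where

    LRRecord RLRecord : Vec (Fin m) n → Pred (Fin n) 0ℓ
    LRRecord π i = ∀ j → j < i → R (lookup π j) (lookup π i)
    RLRecord π i = ∀ j → i < j → R (lookup π j) (lookup π i)

    lrRecord? : (π : Vec (Fin m) n) → Unary.Decidable (LRRecord π)
    lrRecord? π i = all? λ j → (j <? i) →-dec R? (lookup π j) (lookup π i)

    rlRecord? : (π : Vec (Fin m) n) → Unary.Decidable (RLRecord π)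
    rlRecord? π i = all? λ j → (i <? j) →-dec R? (lookup π j) (lookup π i)

    lr rl : Vec (Fin m) n → ℕ
    lr π = count (lrRecord? π) (allFin _)
    rl π = count (rlRecord? π) (allFin _)

    -- These positions of `w` are the ones that remain left-to-right records once `a` is prepended
    -- (`LRRecord-∷`).
    dominated? : ∀ a (w : Vec (Fin m) n) →
      Unary.Decidable (λ i → R a (lookup w i) × LRRecord w i)
    dominated? a w i = R? a (lookup w i) ×-dec lrRecord? w i

    LRRecord-∷ : ∀ {a} {w : Vec (Fin m) n} i →
      LRRecord (a ∷ w) (suc i) ⇔ (R a (lookup w i) × LRRecord w i)
    LRRecord-∷ i = mk⇔
      (λ r → r zero (s≤s z≤n) , λ j j<i → r (suc j) (s≤s j<i))
      (λ { (r , rs) zero _ → r ; (r , rs) (suc j) (s≤s j<i) → rs j j<i })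

    RLRecord-∷ : ∀ {a} {w : Vec (Fin m) n} i → RLRecord (a ∷ w) (suc i) ⇔ RLRecord w i
    RLRecord-∷ i = mk⇔
      (λ r j i<j → r (suc j) (s≤s i<j))
      (λ { r (suc j) (s≤s i<j) → r j i<j })

    lr-∷ : ∀ a (w : Vec (Fin m) n) →
      lr (a ∷ w) ≡ suc (count (dominated? a w) (allFin n))
    lr-∷ a w = trans (count-yes (lrRecord? (a ∷ w)) λ j ())
      (cong suc (count-cong (lrRecord? (a ∷ w) ∘ suc) (dominated? a w) LRRecord-∷ (allFin _)))

    -- Right-to-left records look only to the right, so those of `w` are unaffected and only the new
    -- first position is in question.
    rl-∷-yes : ∀ a (w : Vec (Fin m) n) → (∀ j → R (lookup w j) a) → rl (a ∷ w) ≡ suc (rl w)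
    rl-∷-yes a w r = trans (count-yes (rlRecord? (a ∷ w)) (λ { (suc j) _ → r j }))
      (cong suc (count-cong (rlRecord? (a ∷ w) ∘ suc) (rlRecord? w) RLRecord-∷ (allFin _)))

    rl-∷-no : ∀ a (w : Vec (Fin m) n) j → ¬ R (lookup w j) a → rl (a ∷ w) ≡ rl w
    rl-∷-no a w j ¬r = trans (count-no (rlRecord? (a ∷ w)) (λ r → ¬r (r (suc j) (s≤s z≤n))))
      (count-cong (rlRecord? (a ∷ w) ∘ suc) (rlRecord? w) RLRecord-∷ (allFin _))

    module _ (f : Fin m → Fin k) (embed : ∀ {x y} → R x y ⇔ R (f x) (f y)) where

      private
        R-map : ∀ (w : Vec (Fin m) n) i j →
          R (lookup (map f w) j) (lookup (map f w) i) ⇔ R (lookup w j) (lookup w i)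
        R-map w i j rewrite lookup-map i f w | lookup-map j f w = ⇔.sym embed

      LRRecord-map : ∀ (w : Vec (Fin m) n) i → LRRecord (map f w) i ⇔ LRRecord w i
      LRRecord-map w i = mk⇔
        (λ r j j<i → to (R-map w i j) (r j j<i))
        (λ r j j<i → from (R-map w i j) (r j j<i))

      RLRecord-map : ∀ (w : Vec (Fin m) n) i → RLRecord (map f w) i ⇔ RLRecord w i
      RLRecord-map w i = mk⇔
        (λ r j i<j → to (R-map w i j) (r j i<j))
        (λ r j i<j → from (R-map w i j) (r j i<j))

      rl-map : ∀ (w : Vec (Fin m) n) → rl (map f w) ≡ rl w
      rl-map w = count-cong (rlRecord? (map f w)) (rlRecord? w) (RLRecord-map w) (allFin _)

  module Max = Records {_<_} _<?_
  module Min = Records {λ x y → y < x} (λ x y → y <? x)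

  -- Ascents and descents after prepending an entry.

  ascent? descent? : (w : Vec (Fin m) (suc n)) (i : Fin n) → Dec _
  ascent?  w i = lookup w (inject₁ i) <? lookup w (suc i)
  descent? w i = lookup w (suc i) <? lookup w (inject₁ i)

  module _ (f : Fin m → Fin k) (embed : ∀ {x y} → x < y ⇔ f x < f y) where

    <-map : ∀ (w : Vec (Fin m) n) i j →
      lookup (map f w) i < lookup (map f w) j ⇔ lookup w i < lookup w j
    <-map w i j rewrite lookup-map i f w | lookup-map j f w = ⇔.sym embed

    asc-map : ∀ (w : Vec (Fin m) n) → asc (map f w) ≡ asc w
    asc-map {n = zero}  w = refl
    asc-map {n = suc n} w = count-cong (ascent? (map f w)) (ascent? w)
      (λ i → <-map w (inject₁ i) (suc i)) (allFin _)

    des-map : ∀ (w : Vec (Fin m) n) → des (map f w) ≡ des w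
    des-map {n = zero}  w = refl
    des-map {n = suc n} w = count-cong (descent? (map f w)) (descent? w)
      (λ i → <-map w (suc i) (inject₁ i)) (allFin _)

  module _ (a : Fin (suc m)) (b : Fin m) (w : Vec (Fin m) n) where

    asc-insert-< : a < punchIn a b → asc (insert a (b ∷ w)) ≡ suc (asc (b ∷ w))
    asc-insert-< a<b = trans (count-yes (ascent? (insert a (b ∷ w))) a<b)
      (cong suc (asc-map (punchIn a) (punchIn-mono-< a) (b ∷ w)))

    des-insert-< : a < punchIn a b → des (insert a (b ∷ w)) ≡ des (b ∷ w)
    des-insert-< a<b = trans (count-no (descent? (insert a (b ∷ w))) (ℕ.<⇒≯ a<b))
      (des-map (punchIn a) (punchIn-mono-< a) (b ∷ w))

    asc-insert-> : punchIn a b < a → asc (insert a (b ∷ w)) ≡ asc (b ∷ w)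
    asc-insert-> b<a = trans (count-no (ascent? (insert a (b ∷ w))) (ℕ.<⇒≯ b<a))
      (asc-map (punchIn a) (punchIn-mono-< a) (b ∷ w))

    des-insert-> : punchIn a b < a → des (insert a (b ∷ w)) ≡ suc (des (b ∷ w))
    des-insert-> b<a = trans (count-yes (descent? (insert a (b ∷ w))) b<a)
      (cong suc (des-map (punchIn a) (punchIn-mono-< a) (b ∷ w)))

  -- Record statistics after prepending the largest or second largest value.

  lrmax-insert-top : (σ : Vec (Fin m) n) → lrmax (insert top σ) ≡ 1
  lrmax-insert-top σ = trans (Max.lr-∷ top (map (punchIn top) σ))
    (cong suc (count-none (Max.dominated? top (map (punchIn top) σ))
      (λ i (top< , _) → <⇒≢top top< refl) (allFin _)))

  rlmax-insert-top : (σ : Vec (Fin m) n) → rlmax (insert top σ) ≡ suc (rlmax σ)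
  rlmax-insert-top σ = trans
    (Max.rl-∷-yes top (map (punchIn top) σ) λ j →
      subst (_< top) (sym (lookup-map j (punchIn top) σ)) (punchIn-top-< (lookup σ j)))
    (cong suc (Max.rl-map _ (punchIn-mono-< top) σ))

  -- Everything lies below the new first entry, so all old left-to-right minima survive and the
  -- first position joins them.
  lrmin-insert-top : (σ : Vec (Fin m) n) → lrmin (insert top σ) ≡ suc (lrmin σ)
  lrmin-insert-top σ = trans (Min.lr-∷ top (map (punchIn top) σ))
    (cong suc (count-cong (Min.dominated? top (map (punchIn top) σ)) (Min.lrRecord? σ)
      (λ i → mk⇔
      (λ (_ , r) → to (Min.LRRecord-map _ (punchIn-mono-< top) σ i) r)
      (λ r → subst (_< top) (sym (lookup-map i (punchIn top) σ)) (punchIn-top-< (lookup σ i))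
           , from (Min.LRRecord-map _ (punchIn-mono-< top) σ i) r)) (allFin _)))

  -- The length is positive so that some entry follows `top` and keeps it from being a right-to-left
  -- minimum.
  rlmin-insert-top : (σ : Vec (Fin m) (suc n)) → rlmin (insert top σ) ≡ rlmin σ
  rlmin-insert-top σ = trans
    (Min.rl-∷-no top (map (punchIn top) σ) zero (λ top< → <⇒≢top top< refl))
    (Min.rl-map _ (punchIn-mono-< top) σ)

  module _ {σ : Vec (Fin (suc n)) (suc n)} (σ! : Unique σ) where

    private
      -- The position of the old largest value, the only entry that ends up above `second`. It is a
      -- left-to-right maximum, hence the second one after the new first entry, and it keeps that
      -- entry from being a right-to-left maximum.
      i₀ : Fin (suc n)
      i₀ = proj₁ (Unique⇒surjective σ! top)

      σi₀≡top : lookup σ i₀ ≡ top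
      σi₀≡top = proj₂ (Unique⇒surjective σ! top)

      second<i₀ : second {n} < lookup (map (punchIn second) σ) i₀
      second<i₀ = subst (second <_)
        (sym (trans (lookup-map i₀ (punchIn second) σ) (cong (punchIn second) σi₀≡top)))
        second-<-punchIn

      record-i₀ : Max.LRRecord σ i₀
      record-i₀ j j<i₀ = subst (lookup σ j <_) (sym σi₀≡top) (≢top⇒<top λ σj≡top →
        Fin.<⇒≢ j<i₀ (Unique.lookup-injective σ! j i₀ (trans σj≡top (sym σi₀≡top))))

    lrmax-insert-second : lrmax (insert second σ) ≡ 2
    lrmax-insert-second = trans (Max.lr-∷ second (map (punchIn second) σ))
      (cong suc (count-one (Max.dominated? second (map (punchIn second) σ)) i₀
        (second<i₀ , from (Max.LRRecord-map _ (punchIn-mono-< second) σ i₀) record-i₀)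
        (λ j (second< , _) → Unique.lookup-injective σ! i₀ j (trans σi₀≡top
          (sym (second<⇒top (subst (second <_) (lookup-map j (punchIn second) σ) second<)))))))

    rlmax-insert-second : rlmax (insert second σ) ≡ rlmax σ
    rlmax-insert-second = trans
      (Max.rl-∷-no second (map (punchIn second) σ) i₀ (ℕ.<⇒≯ second<i₀))
      (Max.rl-map _ (punchIn-mono-< second) σ)

  lookup-second-< : ∀ (σ : Vec (Fin (suc m)) n) i →
    lookup σ i ≢ top → lookup (map (punchIn second) σ) i < second
  lookup-second-< σ i ≢top =
    subst (_< second) (sym (lookup-map i (punchIn second) σ)) (punchIn-second-< ≢top)

  -- Position `j` witnesses an entry below the new first one. For a permutation `σ` such a position
  -- is missing only when `σ` has fewer than two entries; that case yields 12 and its extra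
  -- right-to-left minimum.
  rlmin-insert-second : (σ : Vec (Fin (suc m)) n) → ∀ j → lookup σ j ≢ top →
    rlmin (insert second σ) ≡ rlmin σ
  rlmin-insert-second σ j ≢top = trans
    (Min.rl-∷-no second (map (punchIn second) σ) j (ℕ.<⇒≯ (lookup-second-< σ j ≢top)))
    (Min.rl-map _ (punchIn-mono-< second) σ)

  -- When `σ` does not start with its largest value, no left-to-right minimum equals that value:
  -- later ones lie below the first entry. So all of them fall below `second` and survive.
  lrmin-insert-second-≢top : ∀ {a} (w : Vec (Fin (suc m)) n) → a ≢ top →
    lrmin (insert second (a ∷ w)) ≡ suc (lrmin (a ∷ w))
  lrmin-insert-second-≢top {a = a} w a≢top = trans (Min.lr-∷ second (map (punchIn second) σ))
    (cong suc (count-cong (Min.dominated? second (map (punchIn second) σ)) (Min.lrRecord? σ)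
      (λ i → mk⇔
      (λ (_ , r) → to (Min.LRRecord-map _ (punchIn-mono-< second) σ i) r)
      (λ r → lookup-second-< σ i (notTop i r)
           , from (Min.LRRecord-map _ (punchIn-mono-< second) σ i) r)) (allFin _)))
    where
    σ = a ∷ w

    notTop : ∀ i → Min.LRRecord σ i → lookup σ i ≢ top
    notTop zero    r = a≢top
    notTop (suc i) r = <⇒≢top (r zero (s≤s z≤n))

  -- The first entry of `σ` was a left-to-right minimum but now stands above the new first entry. It
  -- is lost, the new first entry replaces it, and the other minima survive.
  lrmin-insert-second-top : (τ : Vec (Fin m) n) →
    lrmin (insert second (insert top τ)) ≡ lrmin (insert top τ)
  lrmin-insert-second-top τ = trans (Min.lr-∷ second (map (punchIn second) σ)) (trans
    (cong suc (trans
      (count-no (Min.dominated? second (map (punchIn second) σ))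
        (λ (top< , _) → ℕ.<⇒≯ top< second-<-punchIn))
      (count-cong (Min.dominated? second (map (punchIn second) σ) ∘ suc) (Min.lrRecord? σ ∘ suc)
        (λ i → mk⇔
        (λ (_ , r) → to (Min.LRRecord-map _ (punchIn-mono-< second) σ (suc i)) r)
        (λ r → lookup-second-< σ (suc i) (<⇒≢top (r zero (s≤s z≤n)))
             , from (Min.LRRecord-map _ (punchIn-mono-< second) σ (suc i)) r)) (allFin _))))
    (sym (count-yes (Min.lrRecord? σ) λ j ())))
    where
    σ = insert top τ

  -- Avoidance as a bound on larger entries to the right.

  FewLarger : Vec (Fin m) n → Set
  FewLarger π = ∀ i j k → i < j → j < k →
    lookup π i < lookup π j → lookup π i < lookup π k → ⊥

  -- A pattern that begins with its smallest letter puts two larger entries to the right of the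
  -- first entry of any occurrence. Both 123 and 132 are of this kind.
  FewLarger⇒Avoids : ∀ (τ : Vec (Fin 3) 3) (π : Vec (Fin m) n) →
    lookup τ 0F < lookup τ 1F → lookup τ 0F < lookup τ 2F → FewLarger π → Avoids τ π
  FewLarger⇒Avoids τ π lt₁ lt₂ few (ι , mono , same) = few _ _ _
    (mono 0F 1F (s≤s z≤n)) (mono 1F 2F (s≤s (s≤s z≤n)))
    (from (same 0F 1F) lt₁)
    (from (same 0F 2F) lt₂)

  increasing₃ : (f : Fin 3 → Fin n) → f 0F < f 1F → f 1F < f 2F →
    ∀ a b → a < b → f a < f b
  increasing₃ f lt₁ lt₂ 0F 1F _ = lt₁
  increasing₃ f lt₁ lt₂ 0F 2F _ = ℕ.<-trans lt₁ lt₂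
  increasing₃ f lt₁ lt₂ 1F 2F _ = lt₂
  increasing₃ f lt₁ lt₂ 1F 1F (s≤s ())
  increasing₃ f lt₁ lt₂ 2F 1F (s≤s ())
  increasing₃ f lt₁ lt₂ 2F 2F (s≤s (s≤s ()))

  -- Both patterns are their own inverses, so `lookup τ a` is also the place of the letter `a` in
  -- `τ`, and `f` reads the chosen entries by rank. Two inequalities between consecutive ranks then
  -- determine the whole order.
  involution-occurrence : ∀ {τ : Vec (Fin 3) 3} {π : Vec (Fin m) n} i j k →
    (∀ a → lookup τ (lookup τ a) ≡ a) → i < j → j < k →
    let f = λ a → lookup π (lookup (i ∷ j ∷ k ∷ []) (lookup τ a)) in
    f 0F < f 1F → f 1F < f 2F → Occurrence τ π (i ∷ j ∷ k ∷ [])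
  involution-occurrence {τ = τ} {π} i j k inv i<j j<k lt₁ lt₂ =
    increasing₃ (lookup ι) i<j j<k , λ a b → mk⇔ (reflect a b) (mono a b)
    where
    ι = i ∷ j ∷ k ∷ []

    mono : ∀ a b → lookup τ a < lookup τ b → lookup π (lookup ι a) < lookup π (lookup ι b)
    mono a b lt = subst₂ (λ x y → lookup π (lookup ι x) < lookup π (lookup ι y)) (inv a) (inv b)
      (increasing₃ (λ a → lookup π (lookup ι (lookup τ a))) lt₁ lt₂ _ _ lt)

    reflect : ∀ a b → lookup π (lookup ι a) < lookup π (lookup ι b) → lookup τ a < lookup τ b
    reflect a b πa<πb with Fin.<-cmp (lookup τ a) (lookup τ b)
    ... | tri< lt _ _ = lt
    -- An involution is injective, so equal letters force `a` and `b` to coincide.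
    ... | tri≈ _ eq _ with refl ← trans (sym (inv a)) (trans (cong (lookup τ) eq) (inv b)) =
      contradiction πa<πb (ℕ.<-irrefl refl)
    ... | tri> _ _ gt = contradiction πa<πb (ℕ.<⇒≯ (mono b a gt))

  -- Distinctness makes the two later entries comparable: in increasing order they complete a 123,
  -- in decreasing order a 132.
  Avoids⇒FewLarger : {π : Vec (Fin m) n} → Unique π →
    Avoids [123] π → Avoids [132] π → FewLarger π
  Avoids⇒FewLarger {π = π} π! a₁ a₂ i j k i<j j<k ij ik with Fin.<-cmp (lookup π j) (lookup π k)
  ... | tri≈ _ eq _ = Fin.<⇒≢ j<k (Unique.lookup-injective π! j k eq)
  ... | tri< jk _ _ = a₁ (i ∷ j ∷ k ∷ [] , involution-occurrence {τ = [123]} {π} i j k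
    (λ { 0F → refl ; 1F → refl ; 2F → refl }) i<j j<k ij jk)
  ... | tri> _ _ kj = a₂ (i ∷ j ∷ k ∷ [] , involution-occurrence {τ = [132]} {π} i j k
    (λ { 0F → refl ; 1F → refl ; 2F → refl }) i<j j<k ik kj)

  FewLarger-tail : ∀ a (w : Vec (Fin m) n) → FewLarger (a ∷ w) → FewLarger w
  FewLarger-tail a w few i j k i<j j<k = few (suc i) (suc j) (suc k) (s≤s i<j) (s≤s j<k)

  module _ (f : Fin m → Fin k) (embed : ∀ {x y} → x < y ⇔ f x < f y) (w : Vec (Fin m) n) where

    FewLarger-map : FewLarger (map f w) ⇔ FewLarger w
    FewLarger-map = mk⇔
      (λ few i j k i<j j<k ij ik →
        few i j k i<j j<k (from (<-map f embed w i j) ij) (from (<-map f embed w i k) ik))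
      (λ few i j k i<j j<k ij ik →
        few i j k i<j j<k (to (<-map f embed w i j) ij) (to (<-map f embed w i k) ik))

  FewLarger-∷ : ∀ a (w : Vec (Fin m) n) → FewLarger w →
    (∀ j k → j < k → a < lookup w j → a < lookup w k → ⊥) → FewLarger (a ∷ w)
  FewLarger-∷ a w few head zero    (suc j) (suc k) _         (s≤s j<k) = head j k j<k
  FewLarger-∷ a w few head (suc i) (suc j) (suc k) (s≤s i<j) (s≤s j<k) = few i j k i<j j<k

  FewLarger-insert-top : (σ : Vec (Fin m) n) → FewLarger σ → FewLarger (insert top σ)
  FewLarger-insert-top σ few = FewLarger-∷ top (map (punchIn top) σ)
    (from (FewLarger-map (punchIn top) (punchIn-mono-< top) σ) few)
    (λ _ _ _ top< _ → <⇒≢top top< refl)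

  -- Only the old largest value exceeds the new first entry, and it occurs at most once.
  FewLarger-insert-second : {σ : Vec (Fin (suc m)) n} → Unique σ → FewLarger σ →
    FewLarger (insert second σ)
  FewLarger-insert-second {σ = σ} σ! few = FewLarger-∷ second (map (punchIn second) σ)
    (from (FewLarger-map (punchIn second) (punchIn-mono-< second) σ) few)
    (λ j k j<k s<j s<k → Fin.<⇒≢ j<k
      (Unique.lookup-injective σ! j k (trans (isTop j s<j) (sym (isTop k s<k)))))
    where
    isTop : ∀ j → second < lookup (map (punchIn second) σ) j → lookup σ j ≡ top
    isTop j s< = second<⇒top (subst (second <_) (lookup-map j (punchIn second) σ) s<)

  -- A first entry smaller than `second` leaves both of the two largest old values above it after
  -- renormalisation, and both stand to its right.
  FewLarger⇒head : ∀ {a : Fin (suc (suc n))} {σ : Vec (Fin (suc n)) (suc n)} → Unique σ →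
    FewLarger (insert a σ) → suc (toℕ a) ℕ.≤ n → ⊥
  FewLarger⇒head {suc n} {a} {σ} σ! few (s≤s a≤n)
    with Unique⇒surjective σ! top | Unique⇒surjective σ! second
  ... | i , σi≡top | j , σj≡second = conflict (Fin.<-cmp i j)
    where
    above : ∀ {v} l → lookup σ l ≡ v → toℕ a ℕ.≤ toℕ v → a < lookup (map (punchIn a) σ) l
    above l refl a≤v = subst (a <_) (sym (lookup-map l (punchIn a) σ)) (<-punchIn a _ a≤v)

    a<i = above i σi≡top
      (ℕ.≤-trans a≤n (ℕ.≤-trans (ℕ.n≤1+n n) (ℕ.≤-reflexive (sym toℕ-top))))
    a<j = above j σj≡second (ℕ.≤-trans a≤n (ℕ.≤-reflexive (sym toℕ-second)))

    conflict : _ → ⊥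
    conflict (tri< i<j _ _) = few zero (suc i) (suc j) (s≤s z≤n) (s≤s i<j) a<i a<j
    conflict (tri> _ _ j<i) = few zero (suc j) (suc i) (s≤s z≤n) (s≤s j<i) a<j a<i
    conflict (tri≈ _ refl _) = top≢second (trans (sym σi≡top) σj≡second)

  -- Recursive enumeration of the avoiders.

  -- An enumeration that agrees with `S n [123] [132]` up to order and along which sums obey
  -- recurrences. It is split by the first entry because the effect of the next insertion depends on
  -- it.
  avoiders : ∀ n → List (Vec (Fin n) n)
  tops seconds : ∀ n → List (Vec (Fin (suc n)) (suc n))

  avoiders zero    = List.[ [] ]
  avoiders (suc n) = tops n List.++ seconds n

  tops n = List.map (insert top) (avoiders n)

  -- A one-letter alphabet has no second largest value.
  seconds zero    = List.[]
  seconds (suc n) = List.map (insert second) (avoiders (suc n))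

  avoiders-Unique×FewLarger : ∀ n → ListAll.All (λ σ → Unique σ × FewLarger σ) (avoiders n)
  tops-Unique×FewLarger : ∀ n → ListAll.All (λ σ → Unique σ × FewLarger σ) (tops n)
  seconds-Unique×FewLarger : ∀ n → ListAll.All (λ σ → Unique σ × FewLarger σ) (seconds n)

  avoiders-Unique×FewLarger zero    = ([] , λ ()) ListAll.∷ ListAll.[]
  avoiders-Unique×FewLarger (suc n) =
    ListAll.++⁺ (tops-Unique×FewLarger n) (seconds-Unique×FewLarger n)

  tops-Unique×FewLarger n = ListAll.map⁺ (ListAll.map
    (λ (σ! , few) → insert-Unique top σ! , FewLarger-insert-top _ few)
    (avoiders-Unique×FewLarger n))

  seconds-Unique×FewLarger zero    = ListAll.[]
  seconds-Unique×FewLarger (suc n) = ListAll.map⁺ (ListAll.map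
    (λ (σ! , few) → insert-Unique second σ! , FewLarger-insert-second σ! few)
    (avoiders-Unique×FewLarger (suc n)))

  insert-∈-avoiders : ∀ (a : Fin (suc n)) {σ : Vec (Fin n) n} →
    Unique σ → FewLarger (insert a σ) → σ ∈ avoiders n → insert a σ ∈ avoiders (suc n)
  insert-∈-avoiders {zero}  0F {[]} _ _ _ = here refl
  -- The index of `a` is `n + 1` (the largest value), `n` (the second largest), or smaller, which
  -- `FewLarger⇒head` rules out.
  insert-∈-avoiders {suc n} a {σ} σ! few σ∈ = go (ℕ.m≤n⇒m<n∨m≡n (ℕ.s≤s⁻¹ (Fin.toℕ<n a)))
    where
    go : _ → insert a σ ∈ avoiders (suc (suc n))
    go (inj₂ a≡) with refl ← toℕ≡⇒≡top a≡ =
      ∈-++⁺ˡ (∈-map⁺ (insert top) σ∈)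
    go (inj₁ (s≤s a≤n)) with ℕ.m≤n⇒m<n∨m≡n a≤n
    ... | inj₁ a<n = ⊥-elim (FewLarger⇒head σ! few a<n)
    ... | inj₂ a≡n with refl ← toℕ≡⇒≡second {j = a} a≡n =
      ∈-++⁺ʳ (tops (suc n)) (∈-map⁺ (insert second) σ∈)

  -- Dropping the first entry and renormalising the rest preserves both hypotheses, so induction
  -- applies to the rest.
  ∈-avoiders : {π : Vec (Fin n) n} → Unique π → FewLarger π → π ∈ avoiders n
  ∈-avoiders {zero}  {[]}    _          _  = here refl
  ∈-avoiders {suc n} {a ∷ w} (a∉w ∷ w!) few with map-punchOut a a∉w
  ... | σ , refl = insert-∈-avoiders a σ! few (∈-avoiders σ!
    (to (FewLarger-map (punchIn a) (punchIn-mono-< a) σ)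
      (FewLarger-tail a (map (punchIn a) σ) few)))
    where σ! = Unique-map⁻ (punchIn a) w!

  insert-injective : ∀ (a : Fin (suc m)) {σ τ : Vec (Fin m) n} → insert a σ ≡ insert a τ → σ ≡ τ
  insert-injective a eq = map-punchIn-injective a (∷-injectiveʳ eq)

  avoiders-unique : ∀ n → ListUnique.Unique (avoiders n)
  avoiders-unique zero          = ListAll.[] ListAllPairs.∷ ListAllPairs.[]
  avoiders-unique (suc zero)    = ListAll.[] ListAllPairs.∷ ListAllPairs.[]
  avoiders-unique (suc (suc n)) = ListUnique.++⁺
    (ListUnique.map⁺ (insert-injective top) (avoiders-unique (suc n)))
    (ListUnique.map⁺ (insert-injective second) (avoiders-unique (suc n)))
    λ (∈tops , ∈seconds) →
      let _ , _ , eq₁ = ∈-map⁻ (insert top) ∈tops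
          _ , _ , eq₂ = ∈-map⁻ (insert second) ∈seconds
      in top≢second (∷-injectiveˡ (trans (sym eq₁) eq₂))

  -- Both lists are free of repetitions, so having the same members makes them rearrangements of
  -- each other.
  S↭avoiders : ∀ n → S n [123] [132] ↭ avoiders n
  S↭avoiders n = ∼bag⇒↭ (unique∧set⇒bag (ListUnique.filter⁺ _ (permutations-unique n))
    (avoiders-unique n) (mk⇔ forward backward))
    where
    forward : ∀ {π} → π ∈ S n [123] [132] → π ∈ avoiders n
    forward {π} π∈ =
      let π∈perm , a₁ , a₂ = ∈-filter⁻ _ {xs = permutations n} π∈
          π! = to (∈-permutations⇔Unique π) π∈perm
      in ∈-avoiders π! (Avoids⇒FewLarger π! a₁ a₂)

    backward : ∀ {π} → π ∈ avoiders n → π ∈ S n [123] [132]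
    backward {π} π∈ =
      let π! , few = ListAll.lookup (avoiders-Unique×FewLarger n) π∈
      in ∈-filter⁺ _ (from (∈-permutations⇔Unique π) π!)
        ( FewLarger⇒Avoids [123] π (s≤s z≤n) (s≤s z≤n) few
        , FewLarger⇒Avoids [132] π (s≤s z≤n) (s≤s z≤n) few)

open Avoiders

-- Solving the linear system for `A` and `B`.

module LinearSystem {c ℓ} (R : CommutativeRing c ℓ) where

  open CommutativeRing R
  open Exp semiring using (_^_)
  open import Algebra.Solver.Ring.NaturalCoefficients.Default commutativeSemiring
  open SetoidReasoning setoid
  open GroupProperties +-group using () renaming (∙-cancelʳ to +-cancelʳ)
  open RingProperties ring using ([y-z]x≈yx-zx)

  -- Passes from a subtraction-free identity, the kind a semiring solver proves, to one between
  -- differences.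
  +⇒- : ∀ w x y z → w + y ≈ z + x → w - x ≈ z - y
  +⇒- w x y z eq = +-cancelʳ (x + y) _ _ (begin
    w - x + (x + y)    ≈⟨ +-assoc _ _ _ ⟨
    w - x + x + y      ≈⟨ +-congʳ (cancel w x) ⟩
    w + y              ≈⟨ eq ⟩
    z + x              ≈⟨ +-congʳ (cancel z y) ⟨
    z - y + y + x      ≈⟨ +-assoc _ _ _ ⟩
    z - y + (y + x)    ≈⟨ +-congˡ (+-comm y x) ⟩
    z - y + (x + y)    ∎)
    where
    cancel : ∀ a b → a - b + b ≈ a
    cancel a b = trans (+-assoc _ _ _) (trans (+-congˡ (-‿inverseˡ b)) (+-identityʳ a))

  x≈1+[-1+x] : ∀ x → x ≈ 1# + (- 1# + x)
  x≈1+[-1+x] x = begin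
    x               ≈⟨ +-identityˡ x ⟨
    0# + x          ≈⟨ +-congʳ (-‿inverseʳ 1#) ⟨
    1# - 1# + x     ≈⟨ +-assoc _ _ _ ⟩
    1# + (- 1# + x) ∎

  -- With the atoms `a` and `b` standing for `x - 1` and `y - 1`, this becomes a semiring identity.
  [-1+x][-1+y] : ∀ x y → (- 1# + x) * (- 1# + y) + (x + y) ≈ x * y + 1#
  [-1+x][-1+y] x y = begin
    a * b + (x + y)
      ≈⟨ +-congˡ (+-cong (x≈1+[-1+x] x) (x≈1+[-1+x] y)) ⟩
    a * b + ((1# + a) + (1# + b))
      ≈⟨ solve 2 (λ a b → a :* b :+ ((con 1 :+ a) :+ (con 1 :+ b)) :=
                          (con 1 :+ a) :* (con 1 :+ b) :+ con 1) refl a b ⟩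
    (1# + a) * (1# + b) + 1#
      ≈⟨ +-congʳ (*-cong (x≈1+[-1+x] x) (x≈1+[-1+x] y)) ⟨
    x * y + 1#      ∎
    where
    a = - 1# + x
    b = - 1# + y

  module _ (P Q U V S T X A B F : Carrier)
    (A-eq : A ≈ X * (V * S * T) + X * (Q * V * S * (A + B)))
    (B-eq : B + X * (X * (P * (V * S * T))) ≈
            X * (P * A) + X * (Q * S * B) + X * (X * (P * (V * S * T) * T)))
    (F-eq : F ≈ 1# + U * A + U * (U * B)) where

    private
      A′ = X * (V * S * T) + X * (Q * V * S * (A + B))
      B₁ = B + X * (X * (P * (V * S * T)))
      B₂ = X * (P * A) + X * (Q * S * B) + X * (X * (P * (V * S * T) * T))
      D⁺ = 1# + Q ^ 2 * S ^ 2 * V * X ^ 2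
      D⁻ = Q * S * X * (1# + V + P * V * X)
      N⁺ = 1# + Q ^ 2 * S ^ 2 * V * X ^ 2 + S * T * U * V * X * (1# + P * T * U * X)

      N⁻ : Carrier → Carrier
      N⁻ w = Q * S * X * (1# + w + V * (1# + P * X + S * T * U * X))

      Z = P * U * V ^ 2 * X ^ 2 * S * T
      e = (- 1# + T) * (- 1# + U)

      -- The coefficients come from the adjugate of the system matrix. With determinant `D⁺ - D⁻`,
      -- the combination `U * A + U * (U * B)` takes `U (1 - QSX) + U² P X` times the equation for
      -- `A` plus `U Q V S X + U² (1 - Q V S X)` times the one for `B`. Positive parts multiply `a`
      -- and `b`, negative parts `a′` and `b′`. The last summand serves the expansion of `e`.
      correction : Carrier → Carrier → Carrier → Carrier → Carrier → Carrier
      correction a a′ b b′ w =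
        (U + U * U * P * X) * a + U * Q * S * X * a′ +
        ((U * Q * V * S * X + U * U) * b + U * U * Q * V * S * X * b′) +
        Q * S * X * Z * w

      -- Cramer's rule for the system in A and B, with all negative terms moved
      -- to the other side; e stands for (T - 1)(U - 1).
      balanced : ∀ e →
        D⁺ * (1# + U * A + U * (U * B)) + N⁻ (Z * e) + correction A′ A B₂ B₁ (T * U + 1#) ≈
        N⁺ + D⁻ * (1# + U * A + U * (U * B)) + correction A A′ B₁ B₂ (e + (T + U))
      balanced = solve 10 (λ P Q U V S T X A B e →
        let A′ = X :* (V :* S :* T) :+ X :* (Q :* V :* S :* (A :+ B))
            B₁ = B :+ X :* (X :* (P :* (V :* S :* T)))
            B₂ = X :* (P :* A) :+ X :* (Q :* S :* B) :+ X :* (X :* (P :* (V :* S :* T) :* T))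
            D⁺ = con 1 :+ Q :^ 2 :* S :^ 2 :* V :* X :^ 2
            D⁻ = Q :* S :* X :* (con 1 :+ V :+ P :* V :* X)
            N⁺ = con 1 :+ Q :^ 2 :* S :^ 2 :* V :* X :^ 2 :+
                 S :* T :* U :* V :* X :* (con 1 :+ P :* T :* U :* X)
            N⁻ = λ w → Q :* S :* X :* (con 1 :+ w :+ V :* (con 1 :+ P :* X :+ S :* T :* U :* X))
            Z = P :* U :* V :^ 2 :* X :^ 2 :* S :* T
            G = con 1 :+ U :* A :+ U :* (U :* B)
            correction = λ a a′ b b′ w →
              (U :+ U :* U :* P :* X) :* a :+ U :* Q :* S :* X :* a′ :+
              ((U :* Q :* V :* S :* X :+ U :* U) :* b :+ U :* U :* Q :* V :* S :* X :* b′) :+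
              Q :* S :* X :* Z :* w
        in D⁺ :* G :+ N⁻ (Z :* e) :+ correction A′ A B₂ B₁ (T :* U :+ con 1)
        := N⁺ :+ D⁻ :* G :+ correction A A′ B₁ B₂ (e :+ (T :+ U)))
        refl P Q U V S T X A B

      -- The system equates the arguments that are exchanged, so the two corrections in `balanced`
      -- cancel.
      correction-≈ : correction A′ A B₂ B₁ (T * U + 1#) ≈ correction A A′ B₁ B₂ (e + (T + U))
      correction-≈ = +-cong
        (+-cong
          (+-cong (*-congˡ (sym A-eq)) (*-congˡ A-eq))
          (+-cong (*-congˡ (sym B-eq)) (*-congˡ B-eq)))
        (*-congˡ (sym ([-1+x][-1+y] T U)))

    linear-system-solution :
      (1# + Q ^ 2 * S ^ 2 * V * X ^ 2 - Q * S * X * (1# + V + P * V * X)) * F ≈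
      1# + Q ^ 2 * S ^ 2 * V * X ^ 2 + S * T * U * V * X * (1# + P * T * U * X)
        - Q * S * X * (1# + P * U * V ^ 2 * X ^ 2 * S * T * (- 1# + T) * (- 1# + U)
                          + V * (1# + P * X + S * T * U * X))
    linear-system-solution = begin
      (D⁺ - D⁻) * F                       ≈⟨ *-congˡ F-eq ⟩
      (D⁺ - D⁻) * (1# + U * A + U * (U * B)) ≈⟨ [y-z]x≈yx-zx _ _ _ ⟩
      D⁺ * (1# + U * A + U * (U * B)) - D⁻ * (1# + U * A + U * (U * B))
        ≈⟨ +⇒- _ _ _ _ (+-cancelʳ _ _ _
             (trans (balanced e) (+-congˡ (sym correction-≈)))) ⟩
      N⁺ - N⁻ (Z * e)
        ≈⟨ +-congˡ (-‿cong (*-congˡ (+-congʳ (+-congˡ (*-assoc Z _ _))))) ⟨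
      N⁺ - N⁻ (Z * (- 1# + T) * (- 1# + U)) ∎

-- Coefficients of series products, and uniqueness of quotients.

module SeriesProperties {c ℓ} (R : CommutativeRing c ℓ) where

  open CommutativeRing R
  open PowerSeries R 
    using (X; const; _⊛_; _/_; /-correct; _≋_; coefficient; coefficientwise)
  private module Ser = CommutativeRing (PowerSeries.commutativeRing R)

  ⊛-zero : ∀ f g → (f ⊛ g) 0 ≈ f 0 * g 0
  ⊛-zero f g = +-identityʳ _

  const-0 : ∀ n → const 0# n ≈ 0#
  const-0 zero    = refl
  const-0 (suc n) = refl

  -- The tail of a constant series is `λ _ → 0#`, which agrees with the ring's zero `const 0#` only
  -- coefficientwise.
  ⊛-zeroˡ : ∀ f → (λ _ → 0#) ⊛ f ≋ const 0#
  ⊛-zeroˡ f = Ser.trans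
    (Ser.*-congʳ (coefficientwise λ n → sym (const-0 n))) (Ser.zeroˡ f)

  const-⊛ : ∀ a f n → (const a ⊛ f) n ≈ a * f n
  const-⊛ a f zero    = ⊛-zero (const a) f
  const-⊛ a f (suc n) = trans
    (+-congˡ (trans (coefficient (⊛-zeroˡ f) n) (const-0 n))) (+-identityʳ _)

  X-⊛-zero : ∀ f → (X ⊛ f) 0 ≈ 0#
  X-⊛-zero f = trans (⊛-zero X f) (zeroˡ _)

  X-⊛-suc : ∀ f n → (X ⊛ f) (suc n) ≈ f n
  X-⊛-suc f n = trans
    (+-cong (zeroˡ _) (coefficient (Ser.*-identityˡ f) n)) (+-identityˡ _)

  X-⊛-const : ∀ a f n → (X ⊛ (const a ⊛ f)) (suc n) ≈ a * f n
  X-⊛-const a f n = trans (X-⊛-suc (const a ⊛ f) n) (const-⊛ a f n)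

  const-* : ∀ a b → const (a * b) ≋ const a ⊛ const b
  const-* a b = coefficientwise λ
    { zero    → sym (const-⊛ a (const b) 0)
    ; (suc n) → sym (trans (const-⊛ a (const b) (suc n)) (zeroʳ a)) }

  -- Constant coefficient 1 makes `d` a unit with inverse `const 1# / d`, so `g` and `f / d`, which
  -- have the same product with `d`, are equal.
  /-unique : ∀ {f g d} → d 0 ≈ 1# → d ⊛ g ≋ f → g ≋ f / d
  /-unique {f} {g} {d} d₀≈1 dg≋f = begin
    g                     ≈⟨ cancel g ⟨
    d⁻¹ ⊛ (d ⊛ g)         ≈⟨ Ser.*-congˡ {d⁻¹} dg≋f ⟩
    d⁻¹ ⊛ f               ≈⟨ Ser.*-congˡ {d⁻¹} (/-correct f d d₀≈1) ⟨
    d⁻¹ ⊛ (d ⊛ (f / d))   ≈⟨ cancel (f / d) ⟩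
    f / d                 ∎
    where
    open SetoidReasoning Ser.setoid
    d⁻¹ = const 1# / d

    cancel : ∀ h → d⁻¹ ⊛ (d ⊛ h) ≋ h
    cancel h = begin
      d⁻¹ ⊛ (d ⊛ h)  ≈⟨ Ser.*-assoc d⁻¹ d h ⟨
      d⁻¹ ⊛ d ⊛ h    ≈⟨ Ser.*-congʳ {h} (Ser.*-comm d⁻¹ d) ⟩
      d ⊛ d⁻¹ ⊛ h    ≈⟨ Ser.*-congʳ {h} (/-correct (const 1#) d d₀≈1) ⟩
      const 1# ⊛ h   ≈⟨ Ser.*-identityˡ h ⟩
      h              ∎

-- Finite sums over lists.

module Sums {c ℓ} (R : CommutativeRing c ℓ) where

  open CommutativeRing R
  open ≡ using (_≡_)

  -- The same fold as in `F`, so each coefficient of `F` is definitionally such a sum.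
  Σ : {A : Set} → (A → Carrier) → List A → Carrier
  Σ f xs = List.foldr _+_ 0# (List.map f xs)

  Σ-↭ : ∀ {A : Set} (f : A → Carrier) {xs ys} → xs ↭ ys → Σ f xs ≈ Σ f ys
  Σ-↭ f Perm.refl         = refl
  Σ-↭ f (Perm.prep x p)   = +-congˡ (Σ-↭ f p)
  Σ-↭ f (Perm.swap x y p) = trans (sym (+-assoc _ _ _))
    (trans (+-cong (+-comm _ _) (Σ-↭ f p)) (+-assoc _ _ _))
  Σ-↭ f (Perm.trans p q)  = trans (Σ-↭ f p) (Σ-↭ f q)

  Σ-++ : ∀ {A : Set} (f : A → Carrier) xs ys → Σ f (xs List.++ ys) ≈ Σ f xs + Σ f ys
  Σ-++ f List.[]       ys = sym (+-identityˡ _)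
  Σ-++ f (x List.∷ xs) ys = trans (+-congˡ (Σ-++ f xs ys)) (sym (+-assoc _ _ _))

  -- The relation is asked of list members only, because the weight relations for `second` rely on
  -- the members having distinct entries.
  Σ-scale : ∀ {A : Set} {f g : A → Carrier} a xs →
    ListAll.All (λ x → f x ≈ a * g x) xs → Σ f xs ≈ a * Σ g xs
  Σ-scale a List.[] ListAll.[]        = sym (zeroʳ a)
  Σ-scale a (_ List.∷ xs) (eq ListAll.∷ eqs) =
    trans (+-cong eq (Σ-scale a xs eqs)) (sym (distribˡ a _ _))

  Σ-map : ∀ {A B : Set} (f : B → Carrier) (h : A → B) xs →
    Σ f (List.map h xs) ≡ Σ (λ x → f (h x)) xs
  Σ-map f h List.[]       = ≡.refl
  Σ-map f h (x List.∷ xs) = ≡.cong (f (h x) +_) (Σ-map f h xs)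

-- Weights under insertion and the recurrences for the generating functions.

module GeneratingFunctions {c ℓ} (R : CommutativeRing c ℓ)
  (p q u v s t : CommutativeRing.Carrier R) where

  open CommutativeRing R
  open ≡ using (_≡_; _≢_)
  open Exp semiring using (_^_)
  open Sums R
  open SeriesProperties R
  open PowerSeries R using (Series; X; const; _⊛_; _⊕_; _≋_; coefficientwise)
  open SetoidReasoning setoid
  open import Algebra.Solver.Ring.NaturalCoefficients.Default commutativeSemiring

  monomial : ℕ → ℕ → ℕ → ℕ → ℕ → ℕ → Carrier
  monomial a d l r l′ r′ = p ^ a * q ^ d * u ^ l * v ^ r * s ^ l′ * t ^ r′

  weight-≡ : ∀ (π : Vec (Fin m) n) {a d l r l′ r′} →
    asc π ≡ a → des π ≡ d →
    lrmax π ≡ l → rlmax π ≡ r → lrmin π ≡ l′ → rlmin π ≡ r′ →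
    weight R p q u v s t π ≡ monomial a d l r l′ r′
  weight-≡ π ≡.refl ≡.refl ≡.refl ≡.refl ≡.refl ≡.refl = ≡.refl

  -- The weight without its factor u ^ lrmax: lrmax is 1 or 2 according to the
  -- choice of the first entry, and so needs no recursion.
  ω : Vec (Fin m) n → Carrier
  ω π = monomial (asc π) (des π) 0 (rlmax π) (lrmin π) (rlmin π)

  ω-≡ : ∀ (π : Vec (Fin m) n) {a d r l′ r′} →
    asc π ≡ a → des π ≡ d →
    rlmax π ≡ r → lrmin π ≡ l′ → rlmin π ≡ r′ → ω π ≡ monomial a d 0 r l′ r′
  ω-≡ π ≡.refl ≡.refl ≡.refl ≡.refl ≡.refl = ≡.refl

  weight-insert-top : (σ : Vec (Fin m) n) →
    weight R p q u v s t (insert top σ) ≈ u * ω (insert top σ)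
  weight-insert-top σ = trans
    (reflexive (weight-≡ π ≡.refl ≡.refl (lrmax-insert-top σ) ≡.refl ≡.refl ≡.refl))
    -- Powers with explicit exponents unfold definitionally, `u ^ 1` to `u * 1#`; the remaining
    -- powers are atoms.
    (solve 6 (λ a b c d e u →
      a :* b :* (u :* con 1) :* c :* d :* e := u :* (a :* b :* con 1 :* c :* d :* e))
      refl (p ^ asc π) (q ^ des π) (v ^ rlmax π) (s ^ lrmin π) (t ^ rlmin π) u)
    where π = insert top σ

  weight-insert-second : (σ : Vec (Fin (suc n)) (suc n)) → Unique σ →
    weight R p q u v s t (insert second σ) ≈ u * u * ω (insert second σ)
  weight-insert-second σ σ! = trans
    (reflexive (weight-≡ π ≡.refl ≡.refl (lrmax-insert-second σ!) ≡.refl ≡.refl ≡.refl))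
    (solve 6 (λ a b c d e u →
      a :* b :* (u :* (u :* con 1)) :* c :* d :* e := u :* u :* (a :* b :* con 1 :* c :* d :* e))
      refl (p ^ asc π) (q ^ des π) (v ^ rlmax π) (s ^ lrmin π) (t ^ rlmin π) u)
    where π = insert second σ

  ω-insert-top : (σ : Vec (Fin m) (suc n)) → ω (insert top σ) ≈ q * v * s * ω σ
  ω-insert-top σ@(b ∷ w) = trans
    (reflexive (ω-≡ (insert top σ)
      (asc-insert-> top b w (punchIn-top-< b)) (des-insert-> top b w (punchIn-top-< b))
      (rlmax-insert-top σ) (lrmin-insert-top σ) (rlmin-insert-top σ)))
    (solve 8 (λ a b c d e q v s →
      a :* (q :* b) :* con 1 :* (v :* c) :* (s :* d) :* e :=
      q :* v :* s :* (a :* b :* con 1 :* c :* d :* e))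
      refl (p ^ asc σ) (q ^ des σ) (v ^ rlmax σ) (s ^ lrmin σ) (t ^ rlmin σ) q v s)

  -- The new first pair is an ascent, and the new first entry merely takes over the role of the old
  -- one as left-to-right minimum, so the factor is `p` alone.
  ω-insert-second-top : (τ : Vec (Fin (suc n)) (suc n)) → Unique (insert top τ) →
    ω (insert second (insert top τ)) ≈ p * ω (insert top τ)
  ω-insert-second-top τ@(b ∷ w) σ! = trans
    (reflexive (ω-≡ (insert second σ)
      (asc-insert-< second top (map (punchIn top) τ) second-<-punchIn)
      (des-insert-< second top (map (punchIn top) τ) second-<-punchIn)
      (rlmax-insert-second σ!) (lrmin-insert-second-top τ)
      -- Position 1 holds the first entry of the nonempty `τ`, which is below the largest.
      (rlmin-insert-second σ 1F (<⇒≢top (punchIn-top-< b)))))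
    (solve 6 (λ a b c d e p →
      p :* a :* b :* con 1 :* c :* d :* e := p :* (a :* b :* con 1 :* c :* d :* e))
      refl (p ^ asc σ) (q ^ des σ) (v ^ rlmax σ) (s ^ lrmin σ) (t ^ rlmin σ) p)
    where σ = insert top τ

  -- The new first pair is a descent and adds a left-to-right minimum, while the largest value,
  -- further right, prevents a new right-to-left maximum.
  ω-insert-second-second : (τ : Vec (Fin (suc n)) (suc n)) → Unique (insert second τ) →
    ω (insert second (insert second τ)) ≈ q * s * ω (insert second τ)
  ω-insert-second-second τ σ! = trans
    (reflexive (ω-≡ (insert second σ)
      (asc-insert-> second second (map (punchIn second) τ) (punchIn-second-< second≢top))
      (des-insert-> second second (map (punchIn second) τ) (punchIn-second-< second≢top))
      (rlmax-insert-second σ!) (lrmin-insert-second-≢top (map (punchIn second) τ) second≢top)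
      (rlmin-insert-second σ 0F second≢top)))
    (solve 7 (λ a b c d e q s →
      a :* (q :* b) :* con 1 :* c :* (s :* d) :* e :=
      q :* s :* (a :* b :* con 1 :* c :* d :* e))
      refl (p ^ asc σ) (q ^ des σ) (v ^ rlmax σ) (s ^ lrmin σ) (t ^ rlmin σ) q s)
    where
    σ = insert second τ

    second≢top : second ≢ top
    second≢top eq = top≢second (≡.sym eq)

  -- The series `A` and `B` of the overview. The index is shifted because `tops n` and `seconds n`
  -- hold words of length `n + 1`.
  topsGF secondsGF : Series
  topsGF zero    = 0#
  topsGF (suc n) = Σ ω (tops n)
  secondsGF zero    = 0#
  secondsGF (suc n) = Σ ω (seconds n)

  Σ-avoiders : ∀ n →
    Σ ω (avoiders (suc n)) ≈ topsGF (suc n) + secondsGF (suc n)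
  Σ-avoiders n = Σ-++ ω (tops n) (seconds n)

  tops-zero : topsGF 1 ≈ v * s * t
  tops-zero = solve 3 (λ v s t →
    con 1 :* con 1 :* con 1 :* (v :* con 1) :* (s :* con 1) :* (t :* con 1) :+ con 0 := v :* s :* t)
    refl v s t

  -- The only word counted is 12. Both of its entries are right-to-left minima, whence the second
  -- factor `t`, which `p * topsGF 1` would not supply.
  seconds-one : secondsGF 2 ≈ p * (v * s * t) * t
  seconds-one = solve 4 (λ p v s t →
      (p :* con 1) :* con 1 :* con 1 :* (v :* con 1) :* (s :* con 1) :* (t :* (t :* con 1)) :+
      con 0 := p :* (v :* s :* t) :* t)
    refl p v s t

  tops-suc : ∀ n → topsGF (suc (suc n)) ≈ q * v * s * (topsGF (suc n) + secondsGF (suc n))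
  tops-suc n = begin
    Σ ω (tops (suc n))
      ≈⟨ reflexive (Σ-map ω (insert top) (avoiders (suc n))) ⟩
    Σ (λ σ → ω (insert top σ)) (avoiders (suc n))
      ≈⟨ Σ-scale (q * v * s) (avoiders (suc n))
           (ListAll.universal ω-insert-top (avoiders (suc n))) ⟩
    q * v * s * Σ ω (avoiders (suc n))
      ≈⟨ *-congˡ (Σ-avoiders n) ⟩
    q * v * s * (topsGF (suc n) + secondsGF (suc n)) ∎

  -- Starts at length 3, where an entry below the new first one always exists; length 2 is
  -- `seconds-one`.
  seconds-suc : ∀ n → secondsGF (suc (suc (suc n))) ≈
    p * topsGF (suc (suc n)) + q * s * secondsGF (suc (suc n))
  seconds-suc n = begin
    Σ ω (seconds (suc (suc n)))
      ≈⟨ reflexive (Σ-map ω (insert second) (avoiders (suc (suc n)))) ⟩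
    Σ ω∘insert (tops (suc n) List.++ seconds (suc n))
      ≈⟨ Σ-++ ω∘insert (tops (suc n)) (seconds (suc n)) ⟩
    Σ ω∘insert (tops (suc n)) + Σ ω∘insert (seconds (suc n))
      ≈⟨ +-cong
           (Σ-scale p (tops (suc n)) (ListAll.map⁺ (ListAll.map
             (λ {σ} (σ! , _) → ω-insert-second-top σ (insert-Unique top σ!))
             (avoiders-Unique×FewLarger (suc n)))))
           (Σ-scale (q * s) (seconds (suc n)) (ListAll.map⁺ (ListAll.map
             (λ {σ} (σ! , _) → ω-insert-second-second σ (insert-Unique second σ!))
             (avoiders-Unique×FewLarger (suc n))))) ⟩
    p * topsGF (suc (suc n)) + q * s * secondsGF (suc (suc n)) ∎
    where
    ω∘insert : Vec (Fin _) _ → Carrier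
    ω∘insert σ = ω (insert second σ)

  topsGF-≋ : topsGF ≋ X ⊛ const (v * s * t) ⊕ X ⊛ (const (q * v * s) ⊛ (topsGF ⊕ secondsGF))
  topsGF-≋ = coefficientwise λ
    { zero    → sym (trans
        (+-cong (X-⊛-zero (const (v * s * t))) (X-⊛-zero (const (q * v * s) ⊛ GF)))
        (+-identityˡ 0#))
    ; (suc n) → trans (step n) (sym (+-cong
        (X-⊛-suc (const (v * s * t)) n) (X-⊛-const (q * v * s) GF n))) }
    where
    GF = topsGF ⊕ secondsGF

    step : ∀ n → topsGF (suc n) ≈
      const (v * s * t) n + q * v * s * (topsGF n + secondsGF n)
    step zero = begin
      topsGF 1                                ≈⟨ tops-zero ⟩
      v * s * t                               ≈⟨ +-identityʳ _ ⟨
      v * s * t + 0#                          ≈⟨ +-congˡ (zeroʳ _) ⟨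
      v * s * t + q * v * s * 0#              ≈⟨ +-congˡ (*-congˡ (+-identityˡ 0#)) ⟨
      v * s * t + q * v * s * (0# + 0#)       ∎
    step (suc n) = trans (tops-suc n) (sym (+-identityˡ _))

  -- The factor `t - 1` of the correction for 12 is split between the two sides to avoid
  -- subtraction.
  secondsGF-≋ :
    secondsGF ⊕ X ⊛ (X ⊛ const (p * (v * s * t))) ≋
    X ⊛ (const p ⊛ topsGF) ⊕ X ⊛ (const (q * s) ⊛ secondsGF) ⊕
    X ⊛ (X ⊛ const (p * (v * s * t) * t))
  secondsGF-≋ = coefficientwise λ
    { zero    → +-cong (sym (trans
                         (+-cong (X-⊛-zero (const p ⊛ topsGF)) (X-⊛-zero (const (q * s) ⊛ secondsGF)))
                         (+-identityˡ 0#)))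
                       (trans (X-⊛-zero (X ⊛ const κ)) (sym (X-⊛-zero (X ⊛ const (κ * t)))))
    ; (suc n) → trans (+-congˡ (X-⊛-suc (X ⊛ const κ) n)) (trans (step n) (sym (+-cong
        (+-cong (X-⊛-const p topsGF n) (X-⊛-const (q * s) secondsGF n))
        (X-⊛-suc (X ⊛ const (κ * t)) n)))) }
    where
    κ = p * (v * s * t)

    step : ∀ n → secondsGF (suc n) + (X ⊛ const κ) n ≈
      p * topsGF n + q * s * secondsGF n + (X ⊛ const (κ * t)) n
    step zero = +-cong
      (sym (trans (+-cong (zeroʳ p) (zeroʳ (q * s))) (+-identityˡ 0#)))
      (trans (X-⊛-zero (const κ)) (sym (X-⊛-zero (const (κ * t)))))
    -- Coefficient 2 is the exceptional one: the recurrence yields `κ` where 12 contributes `κ * t`,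
    -- and the correction terms exchange the two.
    step (suc zero) = begin
      secondsGF 2 + (X ⊛ const κ) 1           ≈⟨ +-cong seconds-one (X-⊛-suc (const κ) 0) ⟩
      κ * t + κ                               ≈⟨ +-comm _ _ ⟩
      κ + κ * t                               ≈⟨ +-congʳ (+-identityʳ κ) ⟨
      κ + 0# + κ * t
        ≈⟨ +-cong (+-cong (*-congˡ tops-zero) (zeroʳ (q * s))) (X-⊛-suc (const (κ * t)) 0) ⟨
      p * topsGF 1 + q * s * secondsGF 1 + (X ⊛ const (κ * t)) 1 ∎
    step (suc (suc n)) = +-cong (seconds-suc n)
      (trans (X-⊛-suc (const κ) (suc n)) (sym (X-⊛-suc (const (κ * t)) (suc n))))

  -- Restores `u ^ lrmax`: one factor `u` when the largest value comes first, two when the second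
  -- largest does. The summand 1 is the empty permutation.
  F-≋ : F R p q u v s t [123] [132] ≋
    const 1# ⊕ const u ⊛ topsGF ⊕ const u ⊛ (const u ⊛ secondsGF)
  F-≋ = coefficientwise λ n → begin
    Σ W (S n [123] [132])                                         ≈⟨ Σ-↭ W (S↭avoiders n) ⟩
    Σ W (avoiders n)                                               ≈⟨ step n ⟩
    const 1# n + u * topsGF n + u * (u * secondsGF n)
      ≈⟨ +-cong (+-congˡ (const-⊛ u topsGF n))
           (trans (const-⊛ u (const u ⊛ secondsGF) n) (*-congˡ (const-⊛ u secondsGF n))) ⟨
    (const 1# ⊕ const u ⊛ topsGF ⊕ const u ⊛ (const u ⊛ secondsGF)) n ∎
    where
    W : Vec (Fin m) n → Carrier
    W = weight R p q u v s t

    Σ-seconds : ∀ n → Σ W (seconds n) ≈ u * u * Σ ω (seconds n)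
    Σ-seconds zero    = sym (zeroʳ (u * u))
    Σ-seconds (suc n) = Σ-scale (u * u) (seconds (suc n)) (ListAll.map⁺ (ListAll.map
      (λ {σ} (σ! , _) → weight-insert-second σ σ!) (avoiders-Unique×FewLarger (suc n))))

    step : ∀ n → Σ W (avoiders n) ≈ const 1# n + u * topsGF n + u * (u * secondsGF n)
    step zero    = solve 1 (λ u →
      con 1 :* con 1 :* con 1 :* con 1 :* con 1 :* con 1 :+ con 0 :=
      con 1 :+ u :* con 0 :+ u :* (u :* con 0)) refl u
    step (suc n) = begin
      Σ W (tops n List.++ seconds n)          ≈⟨ Σ-++ W (tops n) (seconds n) ⟩
      Σ W (tops n) + Σ W (seconds n)
        ≈⟨ +-cong
             (Σ-scale u (tops n) (ListAll.map⁺ (ListAll.universal weight-insert-top (avoiders n))))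
             (Σ-seconds n) ⟩
      u * topsGF (suc n) + u * u * secondsGF (suc n)
        ≈⟨ +-cong (+-identityˡ _) (sym (*-assoc u u _)) ⟨
      0# + u * topsGF (suc n) + u * (u * secondsGF (suc n)) ∎

-- Functional equations in the ring of series, and the closed form.

module FunctionalEquations {c ℓ} (R : CommutativeRing c ℓ)
  (p q u v s t : CommutativeRing.Carrier R) where

  private module R = CommutativeRing R
  open PowerSeries R using (X; const; _≋_; _^_; commutativeRing)
  open CommutativeRing commutativeRing
  open SeriesProperties R using (const-*; ⊛-zero)
  open GeneratingFunctions R p q u v s t
  open RingProperties R.ring using (-0#≈0#)

  private
    P = const p
    Q = const q
    U = const u
    V = const v
    S′ = const s
    T = const t

    -- The recurrences carry products inside a single `const`, whereas the linear system takes each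
    -- indeterminate as a separate series.
    const-*₃ : ∀ a b c → const ((a R.* b) R.* c) ≋ const a * const b * const c
    const-*₃ a b c = trans (const-* (a R.* b) c) (*-congʳ {const c} (const-* a b))

    const-kernel : const (p R.* (v R.* s R.* t)) ≋ P * (V * S′ * T)
    const-kernel = trans (const-* p (v R.* s R.* t)) (*-congˡ {P} (const-*₃ v s t))

  topsGF-eq : topsGF ≋ X * (V * S′ * T) + X * (Q * V * S′ * (topsGF + secondsGF))
  topsGF-eq = trans topsGF-≋ (+-cong
    (*-congˡ {X} (const-*₃ v s t))
    (*-congˡ {X} (*-congʳ {topsGF + secondsGF} (const-*₃ q v s))))

  secondsGF-eq : secondsGF + X * (X * (P * (V * S′ * T))) ≋
    X * (P * topsGF) + X * (Q * S′ * secondsGF) + X * (X * (P * (V * S′ * T) * T))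
  secondsGF-eq = trans
    (+-congˡ {secondsGF} (*-congˡ {X} (*-congˡ {X} (sym const-kernel))))
    (trans secondsGF-≋ (+-cong
      (+-congˡ {X * (P * topsGF)} (*-congˡ {X} (*-congʳ {secondsGF} (const-* q s))))
      (*-congˡ {X} (*-congˡ {X} (trans (const-* (p R.* (v R.* s R.* t)) t)
        (*-congʳ {T} const-kernel))))))

  *-vanishʳ : ∀ f g → g 0 R.≈ R.0# → (f * g) 0 R.≈ R.0#
  *-vanishʳ f g g₀≈0 = R.trans (⊛-zero f g) (R.trans (R.*-congˡ g₀≈0) (R.zeroʳ _))

  *-vanishˡ : ∀ f g → f 0 R.≈ R.0# → (f * g) 0 R.≈ R.0#
  *-vanishˡ f g f₀≈0 = R.trans (⊛-zero f g) (R.trans (R.*-congʳ f₀≈0) (R.zeroˡ _))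

  -- Every term after the leading 1 has a factor `X`. This is what makes the long division by the
  -- denominator meaningful.
  denominator-zero : ∀ a b c → (1# + a * X ^ 2 - b * X * c) 0 R.≈ R.1#
  denominator-zero a b c = R.trans
    (R.+-cong
      (R.trans (R.+-congˡ (*-vanishʳ a (X ^ 2) (*-vanishˡ X (X * 1#) R.refl))) (R.+-identityʳ _))
      (R.trans (R.-‿cong (*-vanishˡ (b * X) c (*-vanishʳ b X R.refl))) -0#≈0#))
    (R.+-identityʳ _)

theorem3 : ∀ {c ℓ} (R : CommutativeRing c ℓ) (p q u v s t : CommutativeRing.Carrier R) →
    let open PowerSeries R
        P = const p
        Q = const q
        U = const u
        V = const v
        S = const s
        T = const t
    in
    F R p q u v s t [123] [132]
      ≈ (1# + Q ^ 2 * S ^ 2 * V * X ^ 2 + S * T * U * V * X * (1# + P * T * U * X)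
           - Q * S * X * (1# + P * U * V ^ 2 * X ^ 2 * S * T * (- 1# + T) * (- 1# + U)
                             + V * (1# + P * X + S * T * U * X)))
        / (1# + Q ^ 2 * S ^ 2 * V * X ^ 2 - Q * S * X * (1# + V + P * V * X))
-- Solving the system in the ring of series gives denominator times `F`; uniqueness of the quotient
-- turns this into the stated fraction.
theorem3 R p q u v s t = SeriesProperties./-unique R
  (denominator-zero (Q ^ 2 * S′ ^ 2 * V) (Q * S′) (1# + V + P * V * X))
  (LinearSystem.linear-system-solution commutativeRing P Q U V S′ T X topsGF secondsGF
    (F R p q u v s t [123] [132]) topsGF-eq secondsGF-eq F-≋)
  where
  open PowerSeries R
  open GeneratingFunctions R p q u v s t
  open FunctionalEquations R p q u v s t
  P = const p
  Q = const q
  U = const u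
  V = const v
  S′ = const s
  T = const t
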